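{- Let $\mathcal{B}$ be a swap structure for $\mathbf{Ciore}$. Then there exist a set $I$ and a monomorphism of algebras $\hat h:\mathcal{B}\to\prod_{i\in I}\mathcal{B}_{\mathbb{A}_2}^{\mathbf{Ciore}}$.
   Context: Let $\Sigma=\{\wedge,\vee,\to,\neg,\circ\}$, with $\wedge,\vee,\to$ binary and $\neg,\circ$ unary. For a Boolean algebra $\mathcal{A}$ with domain $A$ (the one-element Boolean algebra is allowed), with complement $\sim$, put $\mathrm{B}_{\mathcal{A}}^{\mathbf{ciw}}=\{(z_1,z_2)\in A^2 : z_1\vee z_2=1\}$. A swap structure for $\mathbf{Ciore}$ over $\mathcal{A}$ is a multialgebra over $\Sigma$ (a set with operations whose values are nonempty subsets) with domain $B\subseteq\mathrm{B}_{\mathcal{A}}^{\mathbf{ciw}}$, such that $0\in\{z_1:(z_1,z_2)\in B\}$, whose multioperations are single-valued and given, for all $(z_1,z_2),(w_1,w_2)\in B$, by - $(z_1,z_2)\#(w_1,w_2)=\{(z_1\# w_1,\ (z_1\# w_1)\to((z_1\wedge z_2)\wedge(w_1\wedge w_2)))\}$ for each $\#\in\{\wedge,\vee,\to\}$; - $\neg(z_1,z_2)=\{(z_2,z_1)\}$; - $\circ(z_1,z_2)=\{({\sim}(z_1\wedge z_2),\ z_1\wedge z_2)\}$. Being single-valued, such structures are regarded as ordinary algebras over $\Sigma$ (identifying a singleton with its element); monomorphisms of algebras are injective homomorphisms, and products are direct products. A swap structure for $\mathbf{Ciore}$ is one over some Boolean algebra $\mathcal{A}$, and $\mathcal{B}_{\mathcal{A}}^{\mathbf{Ciore}}$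 denotes the one with full domain $\mathrm{B}_{\mathcal{A}}^{\mathbf{ciw}}$. $\mathbb{A}_2$ is the two-element Boolean algebra (so $\mathcal{B}_{\mathbb{A}_2}^{\mathbf{Ciore}}$ has the three elements $(1,0),(1,1),(0,1)$). -}

module Defs where

open import Level using (Level; 0ℓ; _⊔_; suc)
open import Algebra.Core using (Op₁; Op₂)
open import Algebra.Lattice.Bundles using (BooleanAlgebra)
import Algebra.Lattice.Properties.BooleanAlgebra as BooleanAlgebraProperties
open import Data.Bool.Properties using (∨-∧-booleanAlgebra)
open import Data.Product using (_×_; _,_; ∃; proj₁; proj₂)
open import Data.Product.Relation.Binary.Pointwise.NonDependent using (×-setoid)
open import Function.Definitions using (Congruent; Injective)
open import Relation.Binary.Bundles using (Setoid)
open import Relation.Binary.Definitions using (_Respects_)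
import Relation.Binary.Construct.On as On
import Relation.Binary.Reasoning.Setoid as SetoidReasoning
open import Relation.Unary using (Pred; _∈_; _⊆_)

private
  variable
    a ℓ₁ b ℓ₂ c ℓ i p : Level

------------------------------------------------------------------------
-- Algebras over Σ = {∧, ∨, →, ¬, ∘}

data Binary : Set where
  and or imp : Binary

data Unary : Set where
  neg circ : Unary

record ΣAlgebra (a ℓ₁ : Level) : Set (suc (a ⊔ ℓ₁)) where
  field
    setoid : Setoid a ℓ₁

  open Setoid setoid public

  field
    op₂      : Binary → Op₂ Carrier
    op₁      : Unary → Op₁ Carrier
    op₂-cong : ∀ # {x x′ y y′} → x ≈ x′ → y ≈ y′ → op₂ # x y ≈ op₂ # x′ y′
    op₁-cong : ∀ u {x x′} → x ≈ x′ → op₁ u x ≈ op₁ u x′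

record Monomorphism (𝐀 : ΣAlgebra a ℓ₁) (𝐁 : ΣAlgebra b ℓ₂)
                    : Set (a ⊔ ℓ₁ ⊔ b ⊔ ℓ₂) where
  private
    module A = ΣAlgebra 𝐀
    module B = ΣAlgebra 𝐁

  field
    ⟦_⟧       : A.Carrier → B.Carrier
    cong      : Congruent A._≈_ B._≈_ ⟦_⟧
    op₂-homo  : ∀ # x y → ⟦ A.op₂ # x y ⟧ B.≈ B.op₂ # ⟦ x ⟧ ⟦ y ⟧
    op₁-homo  : ∀ u x → ⟦ A.op₁ u x ⟧ B.≈ B.op₁ u ⟦ x ⟧
    injective : Injective A._≈_ B._≈_ ⟦_⟧

∏ : (I : Set i) → (I → ΣAlgebra a ℓ₁) → ΣAlgebra (i ⊔ a) (i ⊔ ℓ₁)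
∏ I 𝐀 = record
  { setoid   = record
    { Carrier       = ∀ i → Carrier (𝐀 i)
    ; _≈_           = λ f g → ∀ i → _≈_ (𝐀 i) (f i) (g i)
    ; isEquivalence = record
      { refl  = λ i → refl (𝐀 i)
      ; sym   = λ f≈g i → sym (𝐀 i) (f≈g i)
      ; trans = λ f≈g g≈h i → trans (𝐀 i) (f≈g i) (g≈h i)
      }
    }
  ; op₂      = λ # f g i → op₂ (𝐀 i) # (f i) (g i)
  ; op₁      = λ u f i → op₁ (𝐀 i) u (f i)
  ; op₂-cong = λ # f≈f′ g≈g′ i → op₂-cong (𝐀 i) # (f≈f′ i) (g≈g′ i)
  ; op₁-cong = λ u f≈f′ i → op₁-cong (𝐀 i) u (f≈f′ i)
  }
  where open ΣAlgebra

------------------------------------------------------------------------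
-- Swap structures for Ciore over a Boolean algebra

module Ciore (𝒜 : BooleanAlgebra c ℓ) where
  open BooleanAlgebra 𝒜 renaming (¬_ to ∼_; setoid to 𝒜-setoid)

  pairs : Setoid c ℓ
  pairs = ×-setoid 𝒜-setoid 𝒜-setoid

  open Setoid pairs public using () renaming (Carrier to Pair; _≈_ to _≈ₚ_)

  infixr 5 _⇒_

  _⇒_ : Op₂ Carrier
  x ⇒ y = ∼ x ∨ y

  ⟦_⟧₂ : Binary → Op₂ Carrier
  ⟦ and ⟧₂ = _∧_
  ⟦ or  ⟧₂ = _∨_
  ⟦ imp ⟧₂ = _⇒_

  swap₂ : Binary → Op₂ Pair
  swap₂ # (z₁ , z₂) (w₁ , w₂) =
    ⟦ # ⟧₂ z₁ w₁ , (⟦ # ⟧₂ z₁ w₁ ⇒ ((z₁ ∧ z₂) ∧ (w₁ ∧ w₂)))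

  swap₁ : Unary → Op₁ Pair
  swap₁ neg  (z₁ , z₂) = z₂ , z₁
  swap₁ circ (z₁ , z₂) = ∼ (z₁ ∧ z₂) , (z₁ ∧ z₂)

  Bᶜⁱʷ : Pred Pair ℓ
  Bᶜⁱʷ (z₁ , z₂) = z₁ ∨ z₂ ≈ ⊤

  -- The multioperations have prescribed one-element values, so a swap
  -- structure is determined by its domain; the closure fields say that
  -- these values are subsets of the domain.
  record SwapStructure (p : Level) : Set (c ⊔ ℓ ⊔ suc p) where
    field
      Domain      : Pred Pair p
      respects    : Domain Respects _≈ₚ_
      Domain⊆Bᶜⁱʷ : Domain ⊆ Bᶜⁱʷ
      0∈π₁        : ⊥ ∈ (λ z₁ → ∃ λ z₂ → (z₁ , z₂) ∈ Domain)
      closed₂     : ∀ # {z w} → z ∈ Domain → w ∈ Domain → swap₂ # z w ∈ Domain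
      closed₁     : ∀ u {z} → z ∈ Domain → swap₁ u z ∈ Domain

  private
    ⇒-cong : ∀ {x x′ y y′} → x ≈ x′ → y ≈ y′ → (x ⇒ y) ≈ (x′ ⇒ y′)
    ⇒-cong p q = ∨-cong (¬-cong p) q

    ⟦⟧₂-cong : ∀ # {x x′ y y′} → x ≈ x′ → y ≈ y′ → ⟦ # ⟧₂ x y ≈ ⟦ # ⟧₂ x′ y′
    ⟦⟧₂-cong and = ∧-cong
    ⟦⟧₂-cong or  = ∨-cong
    ⟦⟧₂-cong imp = ⇒-cong

    swap₂-cong : ∀ # {z z′ w w′} → z ≈ₚ z′ → w ≈ₚ w′ →
                 swap₂ # z w ≈ₚ swap₂ # z′ w′
    swap₂-cong # (p₁ , p₂) (q₁ , q₂) =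
      ⟦⟧₂-cong # p₁ q₁ ,
      ⇒-cong (⟦⟧₂-cong # p₁ q₁) (∧-cong (∧-cong p₁ p₂) (∧-cong q₁ q₂))

    swap₁-cong : ∀ u {z z′} → z ≈ₚ z′ → swap₁ u z ≈ₚ swap₁ u z′
    swap₁-cong neg  (p₁ , p₂) = p₂ , p₁
    swap₁-cong circ (p₁ , p₂) = ¬-cong (∧-cong p₁ p₂) , ∧-cong p₁ p₂

    open SetoidReasoning 𝒜-setoid
    open BooleanAlgebraProperties 𝒜 using (∨-zeroˡ; ∨-zeroʳ)

    x∨[x⇒y]≈⊤ : ∀ x y → x ∨ (x ⇒ y) ≈ ⊤
    x∨[x⇒y]≈⊤ x y = begin
      x ∨ (∼ x ∨ y)  ≈⟨ ∨-assoc _ _ _ ⟨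
      (x ∨ ∼ x) ∨ y  ≈⟨ ∨-congʳ (∨-complementʳ x) ⟩
      ⊤ ∨ y          ≈⟨ ∨-zeroˡ y ⟩
      ⊤              ∎

  algebra : SwapStructure p → ΣAlgebra (c ⊔ p) ℓ
  algebra ℬ = record
    { setoid   = On.setoid {B = ∃ Domain} pairs proj₁
    ; op₂      = λ # (z , z∈) (w , w∈) → swap₂ # z w , closed₂ # z∈ w∈
    ; op₁      = λ u (z , z∈) → swap₁ u z , closed₁ u z∈
    ; op₂-cong = λ # → swap₂-cong #
    ; op₁-cong = λ u → swap₁-cong u
    }
    where open SwapStructure ℬ

  full : SwapStructure ℓ
  full = record
    { Domain      = Bᶜⁱʷ
    ; respects    = λ (p₁ , p₂) z∈ → trans (sym (∨-cong p₁ p₂)) z∈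
    ; Domain⊆Bᶜⁱʷ = λ z∈ → z∈
    ; 0∈π₁        = ⊤ , ∨-zeroʳ ⊥
    ; closed₂     = λ _ _ _ → x∨[x⇒y]≈⊤ _ _
    ; closed₁     = λ where
        neg  z∈ → trans (∨-comm _ _) z∈
        circ _  → ∨-complementˡ _
    }

open Ciore public using (SwapStructure; algebra)

𝔸₂ : BooleanAlgebra 0ℓ 0ℓ
𝔸₂ = ∨-∧-booleanAlgebra

ℬᶜⁱᵒʳᵉ : BooleanAlgebra c ℓ → ΣAlgebra (c ⊔ ℓ) ℓ
ℬᶜⁱᵒʳᵉ 𝒜 = algebra 𝒜 (Ciore.full 𝒜)

{-# OPTIONS --safe #-}

-- The projections of a pair only enter the operations through Boolean terms,
-- so every homomorphism φ : 𝒜 → 𝔸₂ acts componentwise as a homomorphism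
-- ℬ → ℬᶜⁱᵒʳᵉ 𝔸₂. By the ultrafilter theorem these maps separate the points
-- of ℬ, and I can be taken to be the set of all such φ. The ultrafilter
-- theorem rests on Zorn's lemma, which is available because excluded middle
-- for arbitrary types (not just propositions) picks an element of every
-- inhabited type and hence acts as a global choice operator.

module Submission where

open import Defs
open import Level using (Level; _⊔_; Lift; lift)
open import Algebra.Lattice.Bundles using (BooleanAlgebra)
import Algebra.Lattice.Properties.BooleanAlgebra as BooleanAlgebraProperties
open import Axiom.ExcludedMiddle using (ExcludedMiddle)
open import Axiom.Extensionality.Propositional using (Extensionality)
open import Data.Bool.Base as Bool using (Bool; true; false; T; not)
open import Data.Bool.Properties using (⇔→≡; T-≡; T-∧; T?; ∧-inverseʳ; not-injective)
open import Data.Empty using (⊥-elim)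
open import Data.Product using (Σ; ∃; _×_; _,_; proj₁; proj₂; -,_)
open import Data.Sum.Base using (_⊎_; inj₁; inj₂; [_,_])
open import Data.Unit.Base using (tt)
open import Function.Base using (id; _∘_)
open import Function.Bundles using (mk⇔; Equivalence)
import Relation.Binary.Lattice.Bundles as OrderTheoretic
import Relation.Binary.Lattice.Properties.MeetSemilattice as MeetSemilatticeProperties
open import Relation.Binary.PropositionalEquality
  using (_≡_; refl; sym; trans; cong; cong₂; module ≡-Reasoning)
open import Relation.Nullary using (¬_; yes; no; contradiction)
open import Relation.Nullary.Decidable
  using (isYes; toWitness; fromWitness; decidable-stable)
open import Relation.Unary using (Pred)

open ≡-Reasoning

-- Boolean-valued subsets.

private
  variable
    a c ℓ p : Level
    A : Set a

-- Boolean-valued subsets form a small type and, unlike Set-valued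
-- predicates, are equal as soon as they have the same elements.
Subset : Set a → Set a
Subset A = A → Bool

infix 4 _∈_ _⊆_

_∈_ : A → Subset A → Set
x ∈ F = T (F x)

_⊆_ : {A : Set a} → Subset A → Subset A → Set a
F ⊆ G = ∀ {x} → x ∈ F → x ∈ G

Chain : {A : Set a} → Subset (Subset A) → Set a
Chain 𝒮 = ∀ {F G} → F ∈ 𝒮 → G ∈ 𝒮 → F ⊆ G ⊎ G ⊆ F

T-ext : ∀ {b b′} → (T b → T b′) → (T b′ → T b) → b ≡ b′
T-ext f g = ⇔→≡ (mk⇔
  (Equivalence.to T-≡ ∘ f ∘ Equivalence.from T-≡)
  (Equivalence.to T-≡ ∘ g ∘ Equivalence.from T-≡))

¬T⇒≡false : ∀ {b} → ¬ T b → b ≡ false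
¬T⇒≡false ¬Tb = T-ext ¬Tb λ ()

-- Zorn's lemma from excluded middle and extensionality.

module Classical
  (em : ∀ ℓ → ExcludedMiddle ℓ) (ext : ∀ a b → Extensionality a b) where

  ⊆-antisym : (F G : Subset A) → F ⊆ G → G ⊆ F → F ≡ G
  ⊆-antisym _ _ F⊆G G⊆F = ext _ _ λ _ → T-ext F⊆G G⊆F

  comprehension : Pred A p → Subset A
  comprehension P x = isYes (em _ {P x})

  ⋃ : Subset (Subset A) → Subset A
  ⋃ 𝒮 = comprehension λ x → ∃ λ F → F ∈ 𝒮 × x ∈ F

  ⋃-upper : (𝒮 : Subset (Subset A)) {F : Subset A} → F ∈ 𝒮 → F ⊆ ⋃ 𝒮
  ⋃-upper 𝒮 F∈𝒮 x∈F = fromWitness (-, F∈𝒮 , x∈F)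

  ⋃-least : (𝒮 : Subset (Subset A)) {G : Subset A} →
            (∀ {F} → F ∈ 𝒮 → F ⊆ G) → ⋃ 𝒮 ⊆ G
  ⋃-least 𝒮 ub x∈⋃ = let _ , F∈𝒮 , x∈F = toWitness x∈⋃ in ub F∈𝒮 x∈F

  -- The Bourbaki–Witt construction: transfinite iteration of an
  -- inflationary map, without ordinals.
  module _ {A : Set a} (base : Subset A) (next : Subset A → Subset A)
           (next-inflationary : ∀ F → F ⊆ next F) where

    -- An empty family would have the empty union, so asking for a member keeps `base` inside every
    -- stage. That the stages form a chain is derived from this inductive description in
    -- `tower-chain`.
    data Tower : Pred (Subset A) a where
      base⁺  : Tower base
      next⁺  : ∀ {F} → Tower F → Tower (next F)
      union⁺ : ∀ 𝒮 → ∃ (_∈ 𝒮) → (∀ {F} → F ∈ 𝒮 → Tower F) → Tower (⋃ 𝒮)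

    base⊆ : ∀ {F} → Tower F → base ⊆ F
    base⊆ base⁺                     = id
    base⊆ (next⁺ t)                 = next-inflationary _ ∘ base⊆ t
    base⊆ (union⁺ 𝒮 (_ , F∈𝒮) t) x∈ = ⋃-upper 𝒮 F∈𝒮 (base⊆ (t F∈𝒮) x∈)

    -- The extreme elements of the Bourbaki-Witt argument: no stage strictly below `F` can jump past
    -- `F` in one step. Strictness is the failure of the converse inclusion.
    Extreme : Pred (Subset A) a
    Extreme F = ∀ {G} → Tower G → G ⊆ F → ¬ F ⊆ G → next G ⊆ F

    -- Induction on the tower of `G`: while `G` is strictly below `F`, extremality keeps its
    -- successor below `F`; once it reaches `F`, the successor is `next F`.
    extreme⇒comparable : ∀ {F G} → Extreme F → Tower F → Tower G →
                         G ⊆ F ⊎ next F ⊆ G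
    extreme⇒comparable e s base⁺ = inj₁ (base⊆ s)
    extreme⇒comparable {F} e s (next⁺ {G} t) with extreme⇒comparable e s t
    ... | inj₂ nextF⊆G = inj₂ (next-inflationary G ∘ nextF⊆G)
    ... | inj₁ G⊆F with em _ {F ⊆ G}
    ...   | no  F⊈G = inj₁ (e t G⊆F F⊈G)
    -- `next` need not be monotone, so mutual inclusion has to become identity before the successors
    -- can be compared.
    ...   | yes F⊆G with refl ← ⊆-antisym F G F⊆G G⊆F = inj₂ id
    extreme⇒comparable {F} e s (union⁺ 𝒮 _ t)
      with em _ {∃ λ G → G ∈ 𝒮 × next F ⊆ G}
    ... | yes (G , G∈𝒮 , nextF⊆G) = inj₂ (⋃-upper 𝒮 G∈𝒮 ∘ nextF⊆G)
    ... | no  ∄G = inj₁ (⋃-least 𝒮 below)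
      where
      below : ∀ {G} → G ∈ 𝒮 → G ⊆ F
      below G∈𝒮 with extreme⇒comparable e s (t G∈𝒮)
      ... | inj₁ G⊆F     = G⊆F
      ... | inj₂ nextF⊆G = ⊥-elim (∄G (-, G∈𝒮 , nextF⊆G))

    -- Induction on the tower of `F`, with comparability available for each earlier, already extreme
    -- stage. At a union, some member is not contained in `G`; that member lies strictly above `G`
    -- and absorbs `next G`.
    tower⇒extreme : ∀ {F} → Tower F → Extreme F
    tower⇒extreme base⁺ t G⊆F F⊈G = ⊥-elim (F⊈G (base⊆ t))
    tower⇒extreme (next⁺ {F} s) {G} t G⊆F F⊈G
      with extreme⇒comparable (tower⇒extreme s) s t
    ... | inj₂ nextF⊆G = ⊥-elim (F⊈G nextF⊆G)
    ... | inj₁ G⊆F′ with em _ {F ⊆ G}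
    ...   | no  F⊈G′ = next-inflationary F ∘ tower⇒extreme s t G⊆F′ F⊈G′
    ...   | yes F⊆G with refl ← ⊆-antisym F G F⊆G G⊆F′ = id
    tower⇒extreme (union⁺ 𝒮 _ s) {G} t G⊆F F⊈G
      with em _ {∃ λ F → F ∈ 𝒮 × ¬ F ⊆ G}
    ... | no  ∄F = ⊥-elim (F⊈G (⋃-least 𝒮 λ {F} F∈𝒮 →
      decidable-stable (em _ {F ⊆ G}) λ F⊈G′ → ∄F (F , F∈𝒮 , F⊈G′)))
    ... | yes (F , F∈𝒮 , F⊈G′)
      with extreme⇒comparable (tower⇒extreme (s F∈𝒮)) (s F∈𝒮) t
    ...   | inj₁ G⊆F′    = ⋃-upper 𝒮 F∈𝒮 ∘ tower⇒extreme (s F∈𝒮) t G⊆F′ F⊈G′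
    ...   | inj₂ nextF⊆G = ⊥-elim (F⊈G′ (nextF⊆G ∘ next-inflationary F))

    tower-chain : ∀ {F G} → Tower F → Tower G → F ⊆ G ⊎ G ⊆ F
    tower-chain {F} s t with extreme⇒comparable (tower⇒extreme s) s t
    ... | inj₁ G⊆F     = inj₂ G⊆F
    ... | inj₂ nextF⊆G = inj₁ (nextF⊆G ∘ next-inflationary F)

  -- `next` passes to a strictly larger good set whenever one exists, so a good set that contains
  -- its own successor is maximal. The last stage of the tower is such a set.
  zorn : {A : Set a} (Good : Pred (Subset A) p) (base : Subset A) → Good base →
         (∀ 𝒮 → ∃ (_∈ 𝒮) → Chain 𝒮 → (∀ {F} → F ∈ 𝒮 → Good F) → Good (⋃ 𝒮)) →
         ∃ λ M → base ⊆ M × Good M × (∀ {G} → Good G → M ⊆ G → G ⊆ M)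
  zorn {a} {A = A} Good base base-good ⋃-good =
    M , base⊆ _ _ next-inflationary M-tower , good M-tower , M-maximal
    where
    Extends : Subset A → Subset A → Set _
    Extends F G = Good G × F ⊆ G × ¬ G ⊆ F

    next : Subset A → Subset A
    next F with em _ {∃ (Extends F)}
    -- The choice is made here: a positive answer of `em` carries one particular extension.
    ... | yes (G , _) = G
    ... | no  _       = F

    next-inflationary : ∀ F → F ⊆ next F
    next-inflationary F with em _ {∃ (Extends F)}
    ... | yes (_ , _ , F⊆G , _) = F⊆G
    ... | no  _                 = id

    next-good : ∀ F → Good F → Good (next F)
    next-good F F-good with em _ {∃ (Extends F)}
    ... | yes (_ , G-good , _) = G-good
    ... | no  _                = F-good

    fixed⇒maximal : ∀ F → next F ⊆ F → ¬ ∃ (Extends F)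
    fixed⇒maximal F nextF⊆F ∃G with em _ {∃ (Extends F)}
    ... | yes (_ , _ , _ , G⊈F) = G⊈F nextF⊆F
    ... | no  ∄G                = ∄G ∃G

    Stage : Pred (Subset A) a
    Stage = Tower base next next-inflationary

    good : ∀ {F} → Stage F → Good F
    good base⁺                 = base-good
    good (next⁺ t)             = next-good _ (good t)
    good (union⁺ 𝒮 nonempty t) = ⋃-good 𝒮 nonempty
      (λ F∈𝒮 G∈𝒮 → tower-chain base next next-inflationary (t F∈𝒮) (t G∈𝒮))
      (λ F∈𝒮 → good (t F∈𝒮))

    stages : Subset (Subset A)
    stages = comprehension Stage

    M : Subset A
    M = ⋃ stages

    M-tower : Stage M
    -- The family of all stages is itself a Boolean-valued subset, so `union⁺` applies to it and
    -- produces a greatest stage.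
    M-tower = union⁺ stages (base , fromWitness base⁺) toWitness

    M-maximal : ∀ {G} → Good G → M ⊆ G → G ⊆ M
    M-maximal G-good M⊆G = decidable-stable (em _) λ G⊈M →
      -- The successor of `M` is again a stage, hence one of the sets united in `M`.
      fixed⇒maximal M (⋃-upper stages (fromWitness (next⁺ M-tower)))
        (-, G-good , M⊆G , G⊈M)

-- Homomorphisms to the two-element algebra and the order of a Boolean algebra.

record BooleanHomomorphism (𝒜 : BooleanAlgebra c ℓ) : Set (c ⊔ ℓ) where
  open BooleanAlgebra 𝒜 using (Carrier; _≈_; _∧_; _∨_; ⊤) renaming (¬_ to ∼_)
  field
    φ      : Carrier → Bool
    φ-cong : ∀ {x y} → x ≈ y → φ x ≡ φ y
    φ-∧    : ∀ x y → φ (x ∧ y) ≡ φ x Bool.∧ φ y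
    φ-∨    : ∀ x y → φ (x ∨ y) ≡ φ x Bool.∨ φ y
    φ-∼    : ∀ x → φ (∼ x) ≡ not (φ x)
    φ-⊤    : φ ⊤ ≡ true

module BooleanOrder (𝒜 : BooleanAlgebra c ℓ) where
  open BooleanAlgebra 𝒜 using (_≈_; _∧_; _∨_; ⊤; ⊥;
    ∧-congˡ; ∧-distribˡ-∨; ∨-congˡ; ∨-congʳ; ∨-complementʳ)
    renaming (¬_ to ∼_; sym to ≈-sym; trans to ≈-trans)
  open BooleanAlgebraProperties 𝒜 using (∨-∧-orderTheoreticLattice;
    ∧-identityʳ; ∧-zeroˡ; ∨-identityʳ; ∨-identityˡ)
  open OrderTheoretic.Lattice ∨-∧-orderTheoreticLattice public
    using (_≤_; x∧y≤x; x∧y≤y; ∧-greatest; antisym; reflexive; meetSemilattice)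
    renaming (refl to ≤-refl; trans to ≤-trans)
  open MeetSemilatticeProperties meetSemilattice public using (∧-monotonic)

  -- The order is read off the meet: `x ≤ y` unfolds to `x ≈ x ∧ y`, so the inequalities below are
  -- proved as equations.
  x≤⊤ : ∀ x → x ≤ ⊤
  x≤⊤ x = ≈-sym (∧-identityʳ x)

  ⊥≤x : ∀ x → ⊥ ≤ x
  ⊥≤x x = ≈-sym (∧-zeroˡ x)

  split : ∀ x y → x ≈ (x ∧ y) ∨ (x ∧ ∼ y)
  split x y = ≈-trans (≈-sym (∧-identityʳ x))
    (≈-trans (∧-congˡ (≈-sym (∨-complementʳ y))) (∧-distribˡ-∨ x y (∼ y)))

  -- One of the two disjuncts in `split` vanishes; the other is the required meet.
  x∧∼y≤⊥⇒x≤y : ∀ {x y} → x ∧ ∼ y ≤ ⊥ → x ≤ y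
  x∧∼y≤⊥⇒x≤y {x} {y} le = ≈-trans (split x y)
    (≈-trans (∨-congˡ (antisym le (⊥≤x _))) (∨-identityʳ _))

  x∧y≤⊥⇒x≤∼y : ∀ {x y} → x ∧ y ≤ ⊥ → x ≤ ∼ y
  x∧y≤⊥⇒x≤∼y {x} {y} le = ≈-trans (split x y)
    (≈-trans (∨-congʳ (antisym le (⊥≤x _))) (∨-identityˡ _))

-- Ultrafilters and the separation of points.

module Ultrafilters
  (em : ∀ ℓ → ExcludedMiddle ℓ) (ext : ∀ a b → Extensionality a b)
  (𝒜 : BooleanAlgebra c ℓ) where

  open Classical em ext
  open BooleanAlgebra 𝒜 using (Carrier; _≈_; _∧_; _∨_; ⊤; ⊥; ∧-complementʳ)
    renaming (¬_ to ∼_; sym to ≈-sym)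
  open BooleanAlgebraProperties 𝒜 using (deMorgan₂)
  open BooleanOrder 𝒜

  record ProperFilter (F : Subset Carrier) : Set (c ⊔ ℓ) where
    field
      ⊤∈       : ⊤ ∈ F
      ⊥∉       : ¬ ⊥ ∈ F
      up       : ∀ {x y} → x ≤ y → x ∈ F → y ∈ F
      ∧-closed : ∀ {x y} → x ∈ F → y ∈ F → x ∧ y ∈ F

  open ProperFilter

  principal : Carrier → Subset Carrier
  principal x = comprehension (x ≤_)

  principal-proper : ∀ {x} → ¬ x ≤ ⊥ → ProperFilter (principal x)
  principal-proper {x} x≰⊥ = record
    { ⊤∈       = fromWitness (x≤⊤ x)
    ; ⊥∉       = x≰⊥ ∘ toWitness
    ; up       = λ y≤z x≤y → fromWitness (≤-trans (toWitness x≤y) y≤z)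
    ; ∧-closed = λ x≤y x≤z → fromWitness (∧-greatest (toWitness x≤y) (toWitness x≤z))
    }

  ⋃-proper : ∀ 𝒮 → ∃ (_∈ 𝒮) → Chain 𝒮 → (∀ {F} → F ∈ 𝒮 → ProperFilter F) →
             ProperFilter (⋃ 𝒮)
  ⋃-proper 𝒮 (_ , F∈𝒮) chain proper = record
    { ⊤∈ = ⋃-upper 𝒮 F∈𝒮 (⊤∈ (proper F∈𝒮))
    ; ⊥∉ = λ ⊥∈⋃ → let _ , G∈𝒮 , ⊥∈G = toWitness ⊥∈⋃ in ⊥∉ (proper G∈𝒮) ⊥∈G
    ; up = λ x≤y x∈⋃ → let _ , G∈𝒮 , x∈G = toWitness x∈⋃ in
        ⋃-upper 𝒮 G∈𝒮 (up (proper G∈𝒮) x≤y x∈G)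
    ; ∧-closed = λ x∈⋃ y∈⋃ →
        let _ , G∈𝒮 , x∈G = toWitness x∈⋃
            _ , H∈𝒮 , y∈H = toWitness y∈⋃
        in [ (λ G⊆H → ⋃-upper 𝒮 H∈𝒮 (∧-closed (proper H∈𝒮) (G⊆H x∈G) y∈H))
           , (λ H⊆G → ⋃-upper 𝒮 G∈𝒮 (∧-closed (proper G∈𝒮) x∈G (H⊆G y∈H)))
           ] (chain G∈𝒮 H∈𝒮)
    }

  -- The filter generated by `x` together with a filter `F`.
  adjoin : Subset Carrier → Carrier → Subset Carrier
  adjoin F x = comprehension λ y → ∃ λ b → b ∈ F × b ∧ x ≤ y

  -- If `b ∧ x` were zero for some `b` in `F`, then `b ≤ ∼ x` would put `∼ x` into `F`.
  adjoin-proper : ∀ {F x} → ProperFilter F → ¬ ∼ x ∈ F → ProperFilter (adjoin F x)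
  adjoin-proper F-proper ∼x∉F = record
    { ⊤∈ = fromWitness (⊤ , ⊤∈ F-proper , x≤⊤ _)
    ; ⊥∉ = λ ⊥∈ → let _ , b∈F , b∧x≤⊥ = toWitness ⊥∈ in
        ∼x∉F (up F-proper (x∧y≤⊥⇒x≤∼y b∧x≤⊥) b∈F)
    ; up = λ y≤z y∈ → let b , b∈F , b∧x≤y = toWitness y∈ in
        fromWitness (b , b∈F , ≤-trans b∧x≤y y≤z)
    ; ∧-closed = λ y∈ z∈ →
        let b , b∈F , b∧x≤y = toWitness y∈
            d , d∈F , d∧x≤z = toWitness z∈
        in fromWitness (b ∧ d , ∧-closed F-proper b∈F d∈F , ∧-greatest
             (≤-trans (∧-monotonic (x∧y≤x b d) ≤-refl) b∧x≤y)
             (≤-trans (∧-monotonic (x∧y≤y b d) ≤-refl) d∧x≤z))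
    }

  maximal⇒homomorphism : ∀ {M} → ProperFilter M →
                         (∀ {G} → ProperFilter G → M ⊆ G → G ⊆ M) →
                         BooleanHomomorphism 𝒜
  maximal⇒homomorphism {M} proper maximal = record
    { φ      = M
    ; φ-cong = M-cong
    ; φ-∧    = M-∧
    ; φ-∨    = M-∨
    ; φ-∼    = M-∼
    ; φ-⊤    = Equivalence.to T-≡ (⊤∈ proper)
    }
    where
    prime : ∀ x → ¬ ∼ x ∈ M → x ∈ M
    -- The filter generated by `M` and `x` is proper and contains `M`, so maximality returns its
    -- element `x` to `M`.
    prime x ∼x∉M = maximal (adjoin-proper proper ∼x∉M)
      (λ {y} y∈M → fromWitness (y , y∈M , x∧y≤x y x))
      (fromWitness (⊤ , ⊤∈ proper , x∧y≤y ⊤ x))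

    consistent : ∀ x → x ∈ M → ¬ ∼ x ∈ M
    consistent x x∈M ∼x∈M = ⊥∉ proper
      (up proper (reflexive (∧-complementʳ x)) (∧-closed proper x∈M ∼x∈M))

    M-cong : ∀ {x y} → x ≈ y → M x ≡ M y
    M-cong x≈y = T-ext (up proper (reflexive x≈y)) (up proper (reflexive (≈-sym x≈y)))

    M-∧ : ∀ x y → M (x ∧ y) ≡ M x Bool.∧ M y
    M-∧ x y = T-ext
      (λ x∧y∈M → Equivalence.from T-∧
        (up proper (x∧y≤x x y) x∧y∈M , up proper (x∧y≤y x y) x∧y∈M))
      (λ both → let x∈M , y∈M = Equivalence.to T-∧ both in ∧-closed proper x∈M y∈M)

    M-∼ : ∀ x → M (∼ x) ≡ not (M x)
    M-∼ x with M x | prime x | consistent x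
    ... | true  | _      | ∼x∉M = ¬T⇒≡false (∼x∉M tt)
    -- With `M x` false, the conclusion of `prime` is empty, which turns `prime` into a double
    -- negation of `∼ x ∈ M`.
    ... | false | ¬¬∼x∈M | _    = Equivalence.to T-≡ (decidable-stable (T? _) ¬¬∼x∈M)

    M-∨ : ∀ x y → M (x ∨ y) ≡ M x Bool.∨ M y
    -- De Morgan reduces joins to the meets and complements already treated.
    M-∨ x y = not-injective (begin
      not (M (x ∨ y))            ≡⟨ M-∼ (x ∨ y) ⟨
      M (∼ (x ∨ y))              ≡⟨ M-cong (deMorgan₂ x y) ⟩
      M (∼ x ∧ ∼ y)              ≡⟨ M-∧ (∼ x) (∼ y) ⟩
      M (∼ x) Bool.∧ M (∼ y)     ≡⟨ cong₂ Bool._∧_ (M-∼ x) (M-∼ y) ⟩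
      not (M x) Bool.∧ not (M y) ≡⟨ BooleanAlgebraProperties.deMorgan₂ 𝔸₂ (M x) (M y) ⟨
      not (M x Bool.∨ M y)       ∎)

  ultrafilter-theorem : ∀ {x} → ¬ x ≤ ⊥ →
    Σ (BooleanHomomorphism 𝒜) λ h → BooleanHomomorphism.φ h x ≡ true
  ultrafilter-theorem {x} x≰⊥ =
    let M , base⊆M , proper , maximal =
          zorn ProperFilter (principal x) (principal-proper x≰⊥) ⋃-proper
    in maximal⇒homomorphism proper maximal ,
       Equivalence.to T-≡ (base⊆M (fromWitness ≤-refl))

  homomorphisms-separate : ∀ {x y} →
    (∀ (h : BooleanHomomorphism 𝒜) → let open BooleanHomomorphism h in φ x ≡ φ y) →
    x ≈ y
  homomorphisms-separate φx≡φy =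
    antisym (agree⇒≤ φx≡φy) (agree⇒≤ λ h → sym (φx≡φy h))
    where
    agree⇒≤ : ∀ {x y} →
      (∀ (h : BooleanHomomorphism 𝒜) → let open BooleanHomomorphism h in φ x ≡ φ y) →
      x ≤ y
    -- If `x ≤ y` fails, `x ∧ ∼ y` is nonzero, and a homomorphism true there would have to tell `x`
    -- from `y`.
    agree⇒≤ {x} {y} agree = x∧∼y≤⊥⇒x≤y (decidable-stable (em _) λ x∧∼y≰⊥ →
      let h , φ[x∧∼y]≡true = ultrafilter-theorem x∧∼y≰⊥
          open BooleanHomomorphism h
      in contradiction
        (begin
          true                  ≡⟨ φ[x∧∼y]≡true ⟨
          φ (x ∧ ∼ y)           ≡⟨ φ-∧ x (∼ y) ⟩
          φ x Bool.∧ φ (∼ y)    ≡⟨ cong₂ Bool._∧_ (agree h) (φ-∼ y) ⟩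
          φ y Bool.∧ not (φ y)  ≡⟨ ∧-inverseʳ (φ y) ⟩
          false                 ∎)
        λ ())

-- The map of pairs induced by one homomorphism.

module Coordinate (𝒜 : BooleanAlgebra c ℓ) (h : BooleanHomomorphism 𝒜) where
  open BooleanHomomorphism h
  open BooleanAlgebra 𝒜 using (_∧_) renaming (¬_ to ∼_)
  private
    module 𝒜 = Ciore 𝒜
    module 𝟚 = Ciore 𝔸₂

  φ² : 𝒜.Pair → 𝟚.Pair
  φ² (z₁ , z₂) = φ z₁ , φ z₂

  φ²-Bᶜⁱʷ : ∀ {z} → 𝒜.Bᶜⁱʷ z → 𝟚.Bᶜⁱʷ (φ² z)
  φ²-Bᶜⁱʷ z∈ = trans (sym (φ-∨ _ _)) (trans (φ-cong z∈) φ-⊤)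

  φ-⇒ : ∀ x y → φ (x 𝒜.⇒ y) ≡ φ x 𝟚.⇒ φ y
  φ-⇒ x y = trans (φ-∨ (∼ x) y) (cong (Bool._∨ φ y) (φ-∼ x))

  φ-⟦⟧₂ : ∀ # x y → φ (𝒜.⟦ # ⟧₂ x y) ≡ 𝟚.⟦ # ⟧₂ (φ x) (φ y)
  φ-⟦⟧₂ and = φ-∧
  φ-⟦⟧₂ or  = φ-∨
  φ-⟦⟧₂ imp = φ-⇒

  φ²-swap₂ : ∀ # z w → φ² (𝒜.swap₂ # z w) 𝟚.≈ₚ 𝟚.swap₂ # (φ² z) (φ² w)
  φ²-swap₂ # (z₁ , z₂) (w₁ , w₂) = φ-⟦⟧₂ # z₁ w₁ , (begin
    φ (𝒜.⟦ # ⟧₂ z₁ w₁ 𝒜.⇒ ((z₁ ∧ z₂) ∧ (w₁ ∧ w₂)))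
      ≡⟨ φ-⇒ _ _ ⟩
    φ (𝒜.⟦ # ⟧₂ z₁ w₁) 𝟚.⇒ φ ((z₁ ∧ z₂) ∧ (w₁ ∧ w₂))
      ≡⟨ cong₂ 𝟚._⇒_ (φ-⟦⟧₂ # z₁ w₁)
           (trans (φ-∧ _ _) (cong₂ Bool._∧_ (φ-∧ z₁ z₂) (φ-∧ w₁ w₂))) ⟩
    𝟚.⟦ # ⟧₂ (φ z₁) (φ w₁) 𝟚.⇒
      ((φ z₁ Bool.∧ φ z₂) Bool.∧ (φ w₁ Bool.∧ φ w₂)) ∎)

  φ²-swap₁ : ∀ u z → φ² (𝒜.swap₁ u z) 𝟚.≈ₚ 𝟚.swap₁ u (φ² z)
  φ²-swap₁ neg  _         = refl , refl
  φ²-swap₁ circ (z₁ , z₂) =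
    trans (φ-∼ (z₁ ∧ z₂)) (cong not (φ-∧ z₁ z₂)) , φ-∧ z₁ z₂

theorem9p24 : (∀ ℓ → ExcludedMiddle ℓ) → (∀ a b → Extensionality a b) →
    ∀ {c ℓ p} (𝒜 : BooleanAlgebra c ℓ) (ℬ : SwapStructure 𝒜 p) →
    Σ (Set (c ⊔ ℓ ⊔ p)) λ I →
    Monomorphism (algebra 𝒜 ℬ) (∏ I λ _ → ℬᶜⁱᵒʳᵉ 𝔸₂)
-- `Lift` only adjusts the universe level. Over the one-element algebra there are no homomorphisms;
-- the index set is then empty and the product has a single element, as does `ℬ` up to its equality.
theorem9p24 em ext {c} {ℓ} {p} 𝒜 ℬ = Lift p (BooleanHomomorphism 𝒜) , record
  { ⟦_⟧       = λ (z , z∈) (lift h) → let open Coordinate 𝒜 h in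
                  φ² z , φ²-Bᶜⁱʷ (Domain⊆Bᶜⁱʷ z∈)
  ; cong      = λ (z₁≈w₁ , z₂≈w₂) (lift h) → let open BooleanHomomorphism h in
                  φ-cong z₁≈w₁ , φ-cong z₂≈w₂
  ; op₂-homo  = λ # (z , _) (w , _) (lift h) → Coordinate.φ²-swap₂ 𝒜 h # z w
  ; op₁-homo  = λ u (z , _) (lift h) → Coordinate.φ²-swap₁ 𝒜 h u z
  -- Equality in `ℬ` compares the underlying pairs and ignores membership proofs, so each component
  -- is separated on its own.
  ; injective = λ z≈w →
      homomorphisms-separate (λ h → proj₁ (z≈w (lift h))) ,
      homomorphisms-separate (λ h → proj₂ (z≈w (lift h)))
  }
  where
  open SwapStructure ℬ using (Domain⊆Bᶜⁱʷ)
  open Ultrafilters em ext 𝒜 using (homomorphisms-separate)
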